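{- The rules $i{\uparrow}$, $w{\uparrow}$ and $c{\uparrow}$ are admissible for system $\mathsf{KSg}$.
   Context: Structures: generated by $S ::= \mathsf f \mid \mathsf t \mid a \mid [S,\dots,S] \mid (S,\dots,S) \mid \bar S$ (non-empty lists), where $a$ ranges over atoms, $\mathsf f,\mathsf t$ are the units false and true, $[\cdot]$ is disjunction, $(\cdot)$ is conjunction, $\bar S$ is negation; the negation of an atom is again an atom. A context $S\{\ \}$ is a structure with one occurrence of a hole, not in the scope of a negation; $S\{R\}$ is the result of filling it with $R$; $S[R,T]$ abbreviates $S\{[R,T]\}$ and $S(R,T)$ abbreviates $S\{(R,T)\}$. Equivalent structures are not distinguished; equivalence is the smallest equivalence relation induced by: $[\vec R,[\vec T],\vec U]=[\vec R,\vec T,\vec U]$ and $(\vec R,(\vec T),\vec U)=(\vec R,\vec T,\vec U)$ (with $\vec R,\vec T,\vec U$ finite sequences, $\vec T$ non-empty); $[R,T]=[T,R]$, $(R,T)=(T,R)$; $(\mathsf f,\mathsf f)=\mathsf f$, $[\mathsf f,R]=R$, $[\mathsf t,\mathsf t]=\mathsf t$, $(\mathsf t,R)=R$; $\bar{\mathsf f}=\mathsf t$, $\bar{\mathsf t}=\mathsf f$, $\overline{[R,T]}=(\bar R,\bar T)$, $\overline{(R,T)}=[\bar R,\bar T]$, $\bar{\bar R}=R$; and closure: if $R=T$ then $S\{R\}=S\{T\}$ and $\bar R=\bar T$. A derivation in a system (set of inference rules) is a finite sequence of rule instances, read top-down, the conclusion of each being the premise of the next; it may consist of a single structure. A proof of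 $R$ is a derivation with premise $\mathsf t$ and conclusion $R$. Rules (written $\frac{\text{premise}}{\text{conclusion}}$, for arbitrary structures $R,T,U$ and contexts $S\{\ \}$): $i{\downarrow}:\frac{S\{\mathsf t\}}{S[R,\bar R]}$, $i{\uparrow}$ (cut)$:\frac{S(R,\bar R)}{S\{\mathsf f\}}$, $s:\frac{S([R,U],T)}{S[(R,T),U]}$, $w{\downarrow}:\frac{S\{\mathsf f\}}{S\{R\}}$, $w{\uparrow}:\frac{S\{R\}}{S\{\mathsf t\}}$, $c{\downarrow}:\frac{S[R,R]}{S\{R\}}$, $c{\uparrow}:\frac{S\{R\}}{S(R,R)}$. System $\mathsf{KSg}$ is $\{i{\downarrow},s,w{\downarrow},c{\downarrow}\}$. A rule $\rho$ is admissible for a system $\mathcal S$ if for every proof of a structure in $\mathcal S\cup\{\rho\}$ there is a proof of the same structure in $\mathcal S$. -}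

module Defs where

open import Level using (0ℓ) renaming (suc to lsuc)
open import Data.List.Base using (List; []; _∷_)
open import Data.List.NonEmpty.Base using (List⁺; _∷_; _++⁺_; _⁺++_)
open import Relation.Binary.Core using (Rel)
open import Relation.Binary.PropositionalEquality.Core using (_≡_; _≢_)
open import Relation.Unary using (Pred; _∪_; ｛_｝)

-- Atoms form an arbitrary set closed under negation. An atom differs from its
-- negation: with a = ā, contracting [a , ā] would prove a, hence (a , ā), and
-- i↑ would then prove 𝐟, which KSg does not.
record Atoms : Set₁ where
  field
    Atom            : Set
    dual            : Atom → Atom
    dual-involutive : ∀ a → dual (dual a) ≡ a
    dual-distinct   : ∀ a → dual a ≢ a

module Calculus (𝒜 : Atoms) where

  open Atoms 𝒜

  data Structure : Set where
    𝐟 𝐭  : Structure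
    atom : Atom → Structure
    dis  : List⁺ Structure → Structure   -- [ S , … , S ]
    con  : List⁺ Structure → Structure   -- ( S , … , S )
    neg  : Structure → Structure

  infixr 6 _∨_
  infixr 7 _∧_

  _∨_ _∧_ : Structure → Structure → Structure
  R ∨ T = dis (R ∷ T ∷ [])
  R ∧ T = con (R ∷ T ∷ [])

  -- There is no constructor for neg: the hole is never under a negation.
  data Context : Set where
    hole : Context
    dis  : List Structure → Context → List Structure → Context
    con  : List Structure → Context → List Structure → Context

  infix 8 _⟨_⟩

  _⟨_⟩ : Context → Structure → Structure
  hole      ⟨ R ⟩ = R
  dis L S M ⟨ R ⟩ = dis (L ++⁺ (S ⟨ R ⟩ ∷ M))
  con L S M ⟨ R ⟩ = con (L ++⁺ (S ⟨ R ⟩ ∷ M))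

  infix 4 _≈_

  data _≈_ : Rel Structure 0ℓ where
    ≈-refl  : ∀ {R} → R ≈ R
    ≈-sym   : ∀ {R T} → R ≈ T → T ≈ R
    ≈-trans : ∀ {R T U} → R ≈ T → T ≈ U → R ≈ U

    dis-assoc : ∀ Rs Ts Us →
                dis (Rs ++⁺ (dis Ts ∷ Us)) ≈ dis (Rs ++⁺ (Ts ⁺++ Us))
    con-assoc : ∀ Rs Ts Us →
                con (Rs ++⁺ (con Ts ∷ Us)) ≈ con (Rs ++⁺ (Ts ⁺++ Us))

    ∨-comm : ∀ R T → R ∨ T ≈ T ∨ R
    ∧-comm : ∀ R T → R ∧ T ≈ T ∧ R

    𝐟∧𝐟         : 𝐟 ∧ 𝐟 ≈ 𝐟
    ∨-identityˡ : ∀ R → 𝐟 ∨ R ≈ R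
    𝐭∨𝐭         : 𝐭 ∨ 𝐭 ≈ 𝐭
    ∧-identityˡ : ∀ R → 𝐭 ∧ R ≈ R

    neg-𝐟    : neg 𝐟 ≈ 𝐭
    neg-𝐭    : neg 𝐭 ≈ 𝐟
    -- The structure ā is the atom that negates a.
    neg-atom : ∀ a → neg (atom a) ≈ atom (dual a)
    neg-∨    : ∀ R T → neg (R ∨ T) ≈ neg R ∧ neg T
    neg-∧    : ∀ R T → neg (R ∧ T) ≈ neg R ∨ neg T
    neg-neg  : ∀ R → neg (neg R) ≈ R

    context-cong : ∀ S {R T} → R ≈ T → S ⟨ R ⟩ ≈ S ⟨ T ⟩
    neg-cong     : ∀ {R T} → R ≈ T → neg R ≈ neg T

  -- ρ P C: the rule ρ has an instance with premise P and conclusion C.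
  Rule : Set₁
  Rule = Rel Structure 0ℓ

  data i↓ : Rule where
    inst : ∀ S R → i↓ (S ⟨ 𝐭 ⟩) (S ⟨ R ∨ neg R ⟩)

  data i↑ : Rule where
    inst : ∀ S R → i↑ (S ⟨ R ∧ neg R ⟩) (S ⟨ 𝐟 ⟩)

  data s : Rule where
    inst : ∀ S R T U → s (S ⟨ (R ∨ U) ∧ T ⟩) (S ⟨ (R ∧ T) ∨ U ⟩)

  data w↓ : Rule where
    inst : ∀ S R → w↓ (S ⟨ 𝐟 ⟩) (S ⟨ R ⟩)

  data w↑ : Rule where
    inst : ∀ S R → w↑ (S ⟨ R ⟩) (S ⟨ 𝐭 ⟩)

  data c↓ : Rule where
    inst : ∀ S R → c↓ (S ⟨ R ∨ R ⟩) (S ⟨ R ⟩)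

  data c↑ : Rule where
    inst : ∀ S R → c↑ (S ⟨ R ⟩) (S ⟨ R ∧ R ⟩)

  System : Set₂
  System = Pred Rule (lsuc 0ℓ)

  KSg : System
  KSg = ｛ i↓ ｝ ∪ ｛ s ｝ ∪ ｛ w↓ ｝ ∪ ｛ c↓ ｝

  -- Equivalent structures are not distinguished, so adjacent rule instances
  -- (and the two ends of the derivation) need only match up to _≈_.
  data Derivation (𝒮 : System) : Structure → Structure → Set₁ where
    single : ∀ {R T} → R ≈ T → Derivation 𝒮 R T
    step   : ∀ {R P C T} (ρ : Rule) → 𝒮 ρ →
             R ≈ P → ρ P C → Derivation 𝒮 C T → Derivation 𝒮 R T

  Proof : System → Structure → Set₁
  Proof 𝒮 R = Derivation 𝒮 𝐭 R

  Admissible : Rule → System → Set₁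
  Admissible ρ 𝒮 = ∀ R → Proof (𝒮 ∪ ｛ ρ ｝) R → Proof 𝒮 R

{-# OPTIONS --safe #-}

-- All rules of KSg together with the three up rules are sound for a forcing
-- semantics whose worlds are clauses (finite sets of atoms, ordered by
-- inclusion) and in which falsity holds at the clauses containing some a and ā.
-- Conversely KSg is complete for it: a structure R true at the empty clause is
-- provable in KSg, because its conjunctive normal form is tautological and R
-- can be derived from that form by switch and contraction. Working with clauses
-- rather than truth valuations avoids deciding equality of atoms.
module Submission where

open import Defs
open import Algebra.Bundles using (CommutativeMonoid)
import Algebra.Properties.CommutativeSemigroup
open import Data.List.Base using (List; []; _∷_; _++_)
open import Data.List.Membership.Propositional using (_∈_)
open import Data.List.NonEmpty.Base using (List⁺; _∷_; _++⁺_; _⁺++_; toList)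
open import Data.List.Properties using (++-identityʳ)
open import Data.List.Relation.Binary.Subset.Propositional
  using () renaming (_⊆_ to _≼_)
open import Data.List.Relation.Binary.Subset.Propositional.Properties
  using (∈-∷⁺ʳ; xs⊆x∷xs; ∷⁺ʳ) renaming (⊆-refl to ≼-refl; ⊆-trans to ≼-trans)
open import Data.List.Relation.Unary.Any using (here; there)
open import Data.Product using (∃; _×_; _,_; proj₁; proj₂; swap)
open import Data.Sum.Base using (inj₁; inj₂)
open import Data.Unit.Base using (⊤; tt)
open import Function.Base using (id; _∘_)
open import Level using (0ℓ)
open import Relation.Binary.PropositionalEquality
  using (_≡_; refl; sym; cong; subst)
open import Relation.Nullary using (contradiction)
open import Relation.Unary using (Pred; _∪_; ｛_｝)

module Admissibility (𝒜 : Atoms) where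

  open Atoms 𝒜
  open Calculus 𝒜

  -- Tautological clauses.

  Clause : Set
  Clause = List Atom

  Taut : Pred Clause 0ℓ
  Taut Γ = ∃ λ a → a ∈ Γ × dual a ∈ Γ

  Taut-mono : ∀ {Γ Δ} → Γ ≼ Δ → Taut Γ → Taut Δ
  Taut-mono p (a , i , j) = a , p i , p j

  Taut-contract : ∀ {a Γ} → a ∈ Γ → Taut (a ∷ Γ) → Taut Γ
  Taut-contract i = Taut-mono (∈-∷⁺ʳ i id)

  -- This is resolution. The split is on the positions of the complementary pair in the first
  -- clause, so equality of atoms is never decided; `dual-distinct` excludes a pair formed by the
  -- added atom alone.
  Taut-cut : ∀ {a Γ} → Taut (a ∷ Γ) → Taut (dual a ∷ Γ) → Taut Γ
  Taut-cut (_ , here refl , here e)  _ = contradiction e (dual-distinct _)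
  Taut-cut (_ , here refl , there j) t = Taut-contract j t
  Taut-cut (b , there i , here refl) t =
    Taut-contract (subst (_∈ _) (sym (dual-involutive b)) i) t
  Taut-cut (b , there i , there j)   _ = b , i , j

  -- The algebra of stable sets of clauses.

  infix 8 ∼ₚ_

  -- Kripke negation with `Taut` in the role of falsity.
  ∼ₚ_ : Pred Clause 0ℓ → Pred Clause 0ℓ
  (∼ₚ X) Γ = ∀ {Δ} → Γ ≼ Δ → X Δ → Taut Δ

  -- As in a double-negation translation, only sets equal to their double negation serve as truth
  -- values, which makes the classical laws hold constructively.
  record Fact : Set₁ where
    infix 4 _∋_
    field
      _∋_    : Pred Clause 0ℓ
      mono   : ∀ {Γ Δ} → Γ ≼ Δ → _∋_ Γ → _∋_ Δ
      stable : ∀ {Γ} → (∼ₚ ∼ₚ _∋_) Γ → _∋_ Γ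

  open Fact

  -- At a tautological clause every negation holds, in particular the double negation of `X`.
  ex-falso : ∀ X {Γ} → Taut Γ → X ∋ Γ
  ex-falso X t = stable X λ p _ → Taut-mono p t

  ⊥ᶠ ⊤ᶠ : Fact
  ⊥ᶠ = record
    { _∋_    = Taut
    ; mono   = Taut-mono
    ; stable = λ f → f ≼-refl λ _ → id
    }
  ⊤ᶠ = record { _∋_ = λ _ → ⊤ ; mono = _ ; stable = _ }

  -- A world counts its members as false: `a` holds at `Γ` when making `a` false as well is
  -- contradictory. The simpler `dual a ∈ Γ` can fail at a tautological clause, so it would not be
  -- stable.
  atomᶠ : Atom → Fact
  atomᶠ a = record
    { _∋_    = Taut ∘ (a ∷_)
    ; mono   = Taut-mono ∘ ∷⁺ʳ a
    -- The double negation is used at `a ∷ Γ`, where `a` is refuted because it is a member.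
    ; stable = λ f → f (xs⊆x∷xs _ a) λ p → Taut-contract (p (here refl))
    }

  infix  8 ∼_
  infixr 7 _∩_

  ∼_ : Fact → Fact
  ∼ X = record
    { _∋_    = ∼ₚ (X ∋_)
    ; mono   = λ p f q → f (≼-trans p q)
    ; stable = λ f p x → f p λ q g → g ≼-refl (mono X q x)
    }

  _∩_ : Fact → Fact → Fact
  X ∩ Y = record
    { _∋_    = λ Γ → X ∋ Γ × Y ∋ Γ
    ; mono   = λ p (x , y) → mono X p x , mono Y p y
    ; stable = λ f → stable X (λ p g → f p λ q (x , _) → g q x)
                   , stable Y (λ p g → f p λ q (_ , y) → g q y)
    }

  infix 4 _⊑_ _≐_

  _⊑_ _≐_ : Fact → Fact → Set
  X ⊑ Y = ∀ {Γ} → X ∋ Γ → Y ∋ Γ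
  X ≐ Y = X ⊑ Y × Y ⊑ X

  ≐-trans : ∀ X Y Z → X ≐ Y → Y ≐ Z → X ≐ Z
  ≐-trans X Y Z (f , f′) (g , g′) = g ∘ f , f′ ∘ g′

  ∼-anti : ∀ X Y → X ⊑ Y → ∼ Y ⊑ ∼ X
  ∼-anti X Y f g p x = g p (f x)

  ∼-cong : ∀ X Y → X ≐ Y → ∼ X ≐ ∼ Y
  ∼-cong X Y (f , g) = ∼-anti Y X g , ∼-anti X Y f

  ∼∼ : ∀ X → ∼ ∼ X ≐ X
  ∼∼ X = stable X , λ x p f → f ≼-refl (mono X p x)

  -- Interpretation of structures and soundness of equivalence.

  mutual
    -- A union of facts need not be stable, so disjunction is the De Morgan dual of intersection.
    ⟦_⟧ : Structure → Fact
    ⟦ 𝐟 ⟧            = ⊥ᶠ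
    ⟦ 𝐭 ⟧            = ⊤ᶠ
    ⟦ atom a ⟧       = atomᶠ a
    ⟦ dis (R ∷ Rs) ⟧ = ∼ (∼ ⟦ R ⟧ ∩ ⋂ ∼_ Rs)
    ⟦ con (R ∷ Rs) ⟧ = ⟦ R ⟧ ∩ ⋂ id Rs
    ⟦ neg R ⟧        = ∼ ⟦ R ⟧

    ⋂ : (Fact → Fact) → List Structure → Fact
    ⋂ φ []       = ⊤ᶠ
    ⋂ φ (R ∷ Rs) = φ ⟦ R ⟧ ∩ ⋂ φ Rs

  ⋂-++ : ∀ φ Rs {Ts} → ⋂ φ (Rs ++ Ts) ≐ ⋂ φ Rs ∩ ⋂ φ Ts
  ⋂-++ φ []       = (tt ,_) , proj₂
  ⋂-++ φ (R ∷ Rs) with ⋂-++ φ Rs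
  ... | f , g = (λ (x , y) → (x , proj₁ (f y)) , proj₂ (f y))
              , (λ ((x , y) , z) → x , g (y , z))

  -- Serves both associativity laws: for conjunctions `φ` is `id` and the premise is trivial, for
  -- disjunctions `φ` is `∼_` and the premise is double negation.
  ⋂-flatten : ∀ φ R Rs Ts Us → φ ⟦ R ⟧ ≐ ⋂ φ (toList Ts) →
              ⋂ φ (toList (Rs ++⁺ (R ∷ Us))) ≐ ⋂ φ (toList (Rs ++⁺ (Ts ⁺++ Us)))
  ⋂-flatten φ R [] Ts Us (f , g) with ⋂-++ φ (toList Ts)
  ... | h , k = (λ (x , y) → k (f x , y))
              , (λ x → g (proj₁ (h x)) , proj₂ (h x))
  ⋂-flatten φ R (_ ∷ Rs) Ts Us e with ⋂-flatten φ R Rs Ts Us e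
  ... | f , g = (λ (x , y) → x , f y) , (λ (x , y) → x , g y)

  ⋂-mono : ∀ φ R T Rs Us → φ ⟦ R ⟧ ⊑ φ ⟦ T ⟧ →
           ⋂ φ (toList (Rs ++⁺ (R ∷ Us))) ⊑ ⋂ φ (toList (Rs ++⁺ (T ∷ Us)))
  ⋂-mono φ R T []       Us f (x , y) = f x , y
  ⋂-mono φ R T (_ ∷ Rs) Us f (x , y) = x , ⋂-mono φ R T Rs Us f y

  -- The hole is never under a `neg`, and the two negations in the reading of a disjunction cancel.
  -- Soundness of a rule thus reduces to the empty context.
  context-mono : ∀ S R T → ⟦ R ⟧ ⊑ ⟦ T ⟧ → ⟦ S ⟨ R ⟩ ⟧ ⊑ ⟦ S ⟨ T ⟩ ⟧
  context-mono hole          R T f = f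
  context-mono (dis L S M) R T f =
    ∼-anti (⋂ ∼_ (toList (L ++⁺ (S ⟨ T ⟩ ∷ M)))) (⋂ ∼_ (toList (L ++⁺ (S ⟨ R ⟩ ∷ M))))
      (⋂-mono ∼_ (S ⟨ T ⟩) (S ⟨ R ⟩) L M
        (∼-anti ⟦ S ⟨ R ⟩ ⟧ ⟦ S ⟨ T ⟩ ⟧ (context-mono S R T f)))
  context-mono (con L S M) R T f =
    ⋂-mono id (S ⟨ R ⟩) (S ⟨ T ⟩) L M (context-mono S R T f)

  ≈-sound : ∀ {R T} → R ≈ T → ⟦ R ⟧ ≐ ⟦ T ⟧
  ≈-sound ≈-refl                      = id , id
  ≈-sound (≈-sym e)                   = swap (≈-sound e)
  ≈-sound (≈-trans {R} {T} {U} e₁ e₂) =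
    ≐-trans ⟦ R ⟧ ⟦ T ⟧ ⟦ U ⟧ (≈-sound e₁) (≈-sound e₂)
  ≈-sound (dis-assoc Rs Ts Us)        =
    ∼-cong (⋂ ∼_ (toList (Rs ++⁺ (dis Ts ∷ Us)))) (⋂ ∼_ (toList (Rs ++⁺ (Ts ⁺++ Us))))
      (⋂-flatten ∼_ (dis Ts) Rs Ts Us (∼∼ (⋂ ∼_ (toList Ts))))
  ≈-sound (con-assoc Rs Ts Us)        = ⋂-flatten id (con Ts) Rs Ts Us (id , id)
  ≈-sound (∨-comm R T)                =
    (λ f p (t , r , _) → f p (r , t , _)) , (λ f p (r , t , _) → f p (t , r , _))
  ≈-sound (∧-comm R T)                =
    (λ (r , t , _) → t , r , _) , (λ (t , r , _) → r , t , _)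
  ≈-sound 𝐟∧𝐟                         = proj₁ , (λ x → x , x , _)
  ≈-sound (∨-identityˡ R)             =
    (λ f → stable ⟦ R ⟧ λ p g → f p ((λ _ → id) , g , _)) ,
    (λ r p (_ , f , _) → f ≼-refl (mono ⟦ R ⟧ p r))
  ≈-sound 𝐭∨𝐭                         = _ , (λ _ p (f , _) → f ≼-refl tt)
  ≈-sound (∧-identityˡ R)             = proj₁ ∘ proj₂ , (λ r → _ , r , _)
  ≈-sound neg-𝐟                       = _ , (λ _ _ → id)
  ≈-sound neg-𝐭                       =
    (λ f → f ≼-refl tt) , (λ t p _ → Taut-mono p t)
  ≈-sound (neg-atom a)                =
    -- One way, the refutation is used at `dual a ∷ Γ`, where `a` holds; the other way is
    -- resolution.
    (λ f → f (xs⊆x∷xs _ (dual a)) (a , here refl , there (here refl))) ,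
    (λ t p u → Taut-cut u (Taut-mono (∷⁺ʳ (dual a) p) t))
  ≈-sound (neg-∨ R T)                 = ∼∼ (∼ ⟦ R ⟧ ∩ ∼ ⟦ T ⟧ ∩ ⊤ᶠ)
  ≈-sound (neg-∧ R T)                 =
    -- The goal is `Taut`, so both double negations can be opened, each at a further extension.
    (λ f p (g , h , _) → g ≼-refl λ q r → h q λ q′ t →
       f (≼-trans p (≼-trans q q′)) (mono ⟦ R ⟧ q′ r , t , _)) ,
    (λ f p (r , t , _) →
       f p (proj₂ (∼∼ ⟦ R ⟧) r , proj₂ (∼∼ ⟦ T ⟧) t , _))
  ≈-sound (neg-neg R)                 = ∼∼ ⟦ R ⟧
  ≈-sound (context-cong S {R} {T} e)  with ≈-sound e
  ... | f , g = context-mono S R T f , context-mono S T R g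
  ≈-sound (neg-cong {R} {T} e)        = ∼-cong ⟦ R ⟧ ⟦ T ⟧ (≈-sound e)

  -- Soundness of the rules.

  Sound : Rule → Set
  Sound ρ = ∀ {P C} → ρ P C → ⟦ P ⟧ ⊑ ⟦ C ⟧

  i↓-sound : Sound i↓
  i↓-sound (inst S R) = context-mono S 𝐭 (R ∨ neg R) λ _ p (f , g , _) → g ≼-refl f

  i↑-sound : Sound i↑
  i↑-sound (inst S R) = context-mono S (R ∧ neg R) 𝐟 λ (r , f , _) → f ≼-refl r

  s-sound : Sound s
  s-sound (inst S R T U) =
    context-mono S ((R ∨ U) ∧ T) ((R ∧ T) ∨ U) λ (f , t , _) p (g , h , _) →
      -- Where `T` holds, a refutation of `R ∧ T` refutes `R`.
      f p ((λ q r → g q (r , mono ⟦ T ⟧ (≼-trans p q) t , _)) , h , _)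

  w↓-sound : Sound w↓
  w↓-sound (inst S R) = context-mono S 𝐟 R (ex-falso ⟦ R ⟧)

  w↑-sound : Sound w↑
  w↑-sound (inst S R) = context-mono S R 𝐭 _

  c↓-sound : Sound c↓
  c↓-sound (inst S R) =
    context-mono S (R ∨ R) R λ f → stable ⟦ R ⟧ λ p g → f p (g , g , _)

  c↑-sound : Sound c↑
  c↑-sound (inst S R) = context-mono S R (R ∧ R) λ r → r , r , _

  KSg-sound : ∀ {ρ} → KSg ρ → Sound ρ
  KSg-sound (inj₁ refl)               = i↓-sound
  KSg-sound (inj₂ (inj₁ refl))        = s-sound
  KSg-sound (inj₂ (inj₂ (inj₁ refl))) = w↓-sound
  KSg-sound (inj₂ (inj₂ (inj₂ refl))) = c↓-sound

  derivation-sound : ∀ {𝒮 R T} → (∀ {ρ} → 𝒮 ρ → Sound ρ) →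
                     Derivation 𝒮 R T → ⟦ R ⟧ ⊑ ⟦ T ⟧
  derivation-sound σ (single e)       x = proj₁ (≈-sound e) x
  derivation-sound σ (step ρ m e r d) x =
    derivation-sound σ d (σ m r (proj₁ (≈-sound e) x))

  -- Derived equivalences.

  ∨-congˡ : ∀ {R T U} → T ≈ U → R ∨ T ≈ R ∨ U
  ∨-congˡ {R} = context-cong (dis (R ∷ []) hole [])

  ∨-congʳ : ∀ {R T U} → T ≈ U → T ∨ R ≈ U ∨ R
  ∨-congʳ {R} = context-cong (dis [] hole (R ∷ []))

  ∧-congʳ : ∀ {R T U} → T ≈ U → T ∧ R ≈ U ∧ R
  ∧-congʳ {R} = context-cong (con [] hole (R ∷ []))

  ∨-cons : ∀ R T Ts → R ∨ dis (T ∷ Ts) ≈ dis (R ∷ T ∷ Ts)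
  ∨-cons R T Ts =
    subst (λ Us → R ∨ dis (T ∷ Ts) ≈ dis (R ∷ T ∷ Us)) (++-identityʳ Ts)
      (dis-assoc (R ∷ []) (T ∷ Ts) [])

  ∧-cons : ∀ R T Ts → R ∧ con (T ∷ Ts) ≈ con (R ∷ T ∷ Ts)
  ∧-cons R T Ts =
    subst (λ Us → R ∧ con (T ∷ Ts) ≈ con (R ∷ T ∷ Us)) (++-identityʳ Ts)
      (con-assoc (R ∷ []) (T ∷ Ts) [])

  -- `dis-assoc` dissolves a one-element disjunction only inside another disjunction, which the unit
  -- `𝐟` supplies.
  dis-singleton : ∀ R → R ≈ dis (R ∷ [])
  dis-singleton R = ≈-trans (≈-sym (∨-identityˡ R))
    (≈-trans (≈-sym (∨-cons 𝐟 R [])) (∨-identityˡ _))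

  con-singleton : ∀ R → R ≈ con (R ∷ [])
  con-singleton R = ≈-trans (≈-sym (∧-identityˡ R))
    (≈-trans (≈-sym (∧-cons 𝐭 R [])) (∧-identityˡ _))

  ∨-commutativeMonoid : CommutativeMonoid 0ℓ 0ℓ
  ∨-commutativeMonoid = record
    { Carrier = Structure ; _≈_ = _≈_ ; _∙_ = _∨_ ; ε = 𝐟
    ; isCommutativeMonoid = record
      { isMonoid = record
        { isSemigroup = record
          { isMagma = record
            { isEquivalence = record { refl = ≈-refl ; sym = ≈-sym ; trans = ≈-trans }
            ; ∙-cong = λ e₁ e₂ → ≈-trans (∨-congʳ e₁) (∨-congˡ e₂)
            }
          ; assoc = λ R T U → ≈-trans (dis-assoc [] (R ∷ T ∷ []) (U ∷ []))
                                      (≈-sym (∨-cons R T (U ∷ [])))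
          }
        ; identity = ∨-identityˡ , λ R → ≈-trans (∨-comm R 𝐟) (∨-identityˡ R)
        }
      ; comm = ∨-comm
      }
    }

  open CommutativeMonoid ∨-commutativeMonoid
    using (commutativeSemigroup) renaming (assoc to ∨-assoc; identityʳ to ∨-identityʳ)
  open Algebra.Properties.CommutativeSemigroup commutativeSemigroup
    using (x∙yz≈y∙xz; xy∙z≈xz∙y)

  -- Derivations in `KSg`, and their closure under contexts.

  infixr 9 _⊚_

  _⊚_ : Context → Context → Context
  hole      ⊚ S′ = S′
  dis L S M ⊚ S′ = dis L (S ⊚ S′) M
  con L S M ⊚ S′ = con L (S ⊚ S′) M

  ⊚-fill : ∀ S S′ R → (S ⊚ S′) ⟨ R ⟩ ≡ S ⟨ S′ ⟨ R ⟩ ⟩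
  ⊚-fill hole        S′ R = refl
  ⊚-fill (dis L S M) S′ R = cong (λ T → dis (L ++⁺ (T ∷ M))) (⊚-fill S S′ R)
  ⊚-fill (con L S M) S′ R = cong (λ T → con (L ++⁺ (T ∷ M))) (⊚-fill S S′ R)

  infix 4 _⟶_ ⊢_

  _⟶_ : Structure → Structure → Set₁
  _⟶_ = Derivation KSg

  ⊢_ : Structure → Set₁
  ⊢_ = Proof KSg

  infixl 5 _≈⨾_ _⨾_ _⨾≈_

  _≈⨾_ : ∀ {R T U} → R ≈ T → T ⟶ U → R ⟶ U
  e ≈⨾ single e′        = single (≈-trans e e′)
  e ≈⨾ step ρ m e′ r d  = step ρ m (≈-trans e e′) r d

  _⨾_ : ∀ {R T U} → R ⟶ T → T ⟶ U → R ⟶ U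
  single e       ⨾ d′ = e ≈⨾ d′
  step ρ m e r d ⨾ d′ = step ρ m e r (d ⨾ d′)

  _⨾≈_ : ∀ {R T U} → R ⟶ T → T ≈ U → R ⟶ U
  d ⨾≈ e = d ⨾ single e

  rule : ∀ {ρ : Rule} {P C} → KSg ρ → ρ P C → P ⟶ C
  rule m r = step _ m ≈-refl r (single ≈-refl)

  identity↓ : ∀ R → 𝐭 ⟶ R ∨ neg R
  identity↓ R = rule (inj₁ refl) (inst hole R)

  switch : ∀ R T U → (R ∨ U) ∧ T ⟶ (R ∧ T) ∨ U
  switch R T U = rule (inj₂ (inj₁ refl)) (inst hole R T U)

  weaken : ∀ R → 𝐟 ⟶ R
  weaken R = rule (inj₂ (inj₂ (inj₁ refl))) (inst hole R)

  contract : ∀ R → R ∨ R ⟶ R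
  contract R = rule (inj₂ (inj₂ (inj₂ refl))) (inst hole R)

  -- An instance already carries a context `S′`; placing it inside `S` gives an instance with
  -- context `S ⊚ S′`.
  plug-rule : ∀ S {ρ P C} → KSg ρ → ρ P C → S ⟨ P ⟩ ⟶ S ⟨ C ⟩
  plug-rule S (inj₁ refl) (inst S′ R)
    rewrite sym (⊚-fill S S′ 𝐭) | sym (⊚-fill S S′ (R ∨ neg R))
    = rule (inj₁ refl) (inst (S ⊚ S′) R)
  plug-rule S (inj₂ (inj₁ refl)) (inst S′ R T U)
    rewrite sym (⊚-fill S S′ ((R ∨ U) ∧ T)) | sym (⊚-fill S S′ ((R ∧ T) ∨ U))
    = rule (inj₂ (inj₁ refl)) (inst (S ⊚ S′) R T U)
  plug-rule S (inj₂ (inj₂ (inj₁ refl))) (inst S′ R)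
    rewrite sym (⊚-fill S S′ 𝐟) | sym (⊚-fill S S′ R)
    = rule (inj₂ (inj₂ (inj₁ refl))) (inst (S ⊚ S′) R)
  plug-rule S (inj₂ (inj₂ (inj₂ refl))) (inst S′ R)
    rewrite sym (⊚-fill S S′ (R ∨ R)) | sym (⊚-fill S S′ R)
    = rule (inj₂ (inj₂ (inj₂ refl))) (inst (S ⊚ S′) R)

  plug : ∀ S {R T} → R ⟶ T → S ⟨ R ⟩ ⟶ S ⟨ T ⟩
  plug S (single e)       = single (context-cong S e)
  plug S (step ρ m e r d) = context-cong S e ≈⨾ plug-rule S m r ⨾ plug S d

  ∨-monoˡ : ∀ {R T U} → R ⟶ T → R ∨ U ⟶ T ∨ U
  ∨-monoˡ {U = U} = plug (dis [] hole (U ∷ []))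

  ∨-monoʳ : ∀ {R T U} → R ⟶ T → U ∨ R ⟶ U ∨ T
  ∨-monoʳ {U = U} = plug (dis (U ∷ []) hole [])

  ⊢-∧ : ∀ {R T} → ⊢ R → ⊢ T → ⊢ R ∧ T
  ⊢-∧ {R} {T} d e =
    ≈-sym (∧-identityˡ 𝐭)
    ≈⨾ plug (con [] hole (𝐭 ∷ [])) d
    ⨾  plug (con (R ∷ []) hole []) e

  ⊢-weaken : ∀ {R T} → ⊢ R → ⊢ R ∨ T
  ⊢-weaken {R} {T} d = d ⨾≈ ≈-sym (∨-identityʳ R) ⨾ ∨-monoʳ (weaken T)

  -- Each of two switches moves one copy of `U` out of the conjunction, and contraction merges the
  -- copies.
  distribute : ∀ R T U → (R ∨ U) ∧ (T ∨ U) ⟶ (R ∧ T) ∨ U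
  distribute R T U =
    switch R (T ∨ U) U
    ⨾≈ ∨-congʳ (∧-comm R (T ∨ U))
    ⨾  ∨-monoˡ (switch T R U)
    ⨾≈ ∨-assoc (T ∧ R) U U
    ⨾  ∨-monoʳ (contract U)
    ⨾≈ ∨-congʳ (∧-comm T R)

  -- Completeness of `KSg`.

  ⌈_⌉ : Clause → Structure
  ⌈ [] ⌉    = 𝐟
  ⌈ a ∷ Γ ⌉ = atom a ∨ ⌈ Γ ⌉

  absorb : ∀ {a Γ} → a ∈ Γ → ⌈ Γ ⌉ ∨ atom a ⟶ ⌈ Γ ⌉
  absorb {a} {_ ∷ Γ} (here refl) =
    xy∙z≈xz∙y (atom a) ⌈ Γ ⌉ (atom a) ≈⨾ ∨-monoˡ (contract (atom a))
  absorb {a} {b ∷ Γ} (there i)   =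
    ∨-assoc (atom b) ⌈ Γ ⌉ (atom a) ≈⨾ ∨-monoʳ (absorb i)

  -- Rather than splitting `Γ` around the complementary pair, all of `⌈ Γ ⌉` is weakened in beside a
  -- fresh copy of the pair, whose atoms are then contracted into it.
  Taut-provable : ∀ {Γ} → Taut Γ → ⊢ ⌈ Γ ⌉
  Taut-provable {Γ} (a , i , j) =
    identity↓ (atom a)
    ⨾≈ ∨-congˡ (neg-atom a)
    ⨾≈ ≈-sym (∨-identityˡ _)
    ⨾  ∨-monoˡ (weaken ⌈ Γ ⌉)
    ⨾≈ ≈-sym (∨-assoc ⌈ Γ ⌉ (atom a) (atom (dual a)))
    ⨾  ∨-monoˡ (absorb i)
    ⨾  absorb j

  -- The clauses Δ with ∼ ⟦ R ⟧ ∋ Δ are those that R implies, in particular those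
  -- of its conjunctive normal form. The side structure U lets a disjunction be
  -- treated one disjunct at a time.
  Complete : Structure → Set₁
  Complete R = ∀ {U Γ} → (∀ {Δ} → Γ ≼ Δ → ∼ ⟦ R ⟧ ∋ Δ → ⊢ U ∨ ⌈ Δ ⌉) →
               ⊢ R ∨ (U ∨ ⌈ Γ ⌉)

  -- Reduces longer lists and negations to units, atoms and the binary connectives.
  Complete-resp : ∀ {R T} → R ≈ T → Complete R → Complete T
  Complete-resp {R} {T} e c k =
    c (λ p f → k p (∼-anti ⟦ T ⟧ ⟦ R ⟧ (proj₂ (≈-sound e)) f)) ⨾≈ ∨-congʳ e

  Complete-𝐟 : Complete 𝐟
  Complete-𝐟 k = k ≼-refl (λ _ → id) ⨾≈ ≈-sym (∨-identityˡ _)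

  Complete-𝐭 : Complete 𝐭
  Complete-𝐭 _ = ⊢-weaken (single ≈-refl)

  Complete-atom : ∀ a → Complete (atom a)
  Complete-atom a {U} {Γ} k =
    -- The clause `a ∷ Γ` is implied by `a`, its member.
    k (xs⊆x∷xs Γ a) (λ p → Taut-contract (p (here refl)))
    ⨾≈ x∙yz≈y∙xz U (atom a) ⌈ Γ ⌉

  -- A clause implied by either conjunct is implied by `R ∧ T`, so the same `k` serves both.
  Complete-∧ : ∀ {R T} → Complete R → Complete T → Complete (R ∧ T)
  Complete-∧ {R} {T} c d {U} {Γ} k =
    ⊢-∧ (c λ p f → k p λ q (r , _) → f q r)
        (d λ p f → k p λ q (_ , t , _) → f q t)
    ⨾ distribute R T (U ∨ ⌈ Γ ⌉)

  -- `R` is treated first, with side structure `T ∨ U`; at each clause `Δ` it implies, `T` is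
  -- treated with side structure `U`. Extensions of `Δ` implied by `T` are still implied by `R`,
  -- hence by `R ∨ T`.
  Complete-∨ : ∀ {R T} → Complete R → Complete T → Complete (R ∨ T)
  Complete-∨ {R} {T} c d {U} {Γ} k =
    c (λ {Δ} p f →
      d (λ p′ g → k (≼-trans p p′) λ q h →
           h ≼-refl (mono (∼ ⟦ R ⟧) (≼-trans p′ q) f , mono (∼ ⟦ T ⟧) q g , _))
      ⨾≈ ≈-sym (∨-assoc T U ⌈ Δ ⌉))
    ⨾≈ ∨-congˡ (∨-assoc T U ⌈ Γ ⌉)
    ⨾≈ ≈-sym (∨-assoc R T (U ∨ ⌈ Γ ⌉))

  mutual
    complete : ∀ R → Complete R
    complete 𝐟              = Complete-𝐟
    complete 𝐭              = Complete-𝐭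
    complete (atom a)       = Complete-atom a
    complete (dis (R ∷ Rs)) = complete-dis R Rs
    complete (con (R ∷ Rs)) = complete-con R Rs
    complete (neg R)        = complete-neg R

    complete-dis : ∀ R Rs → Complete (dis (R ∷ Rs))
    complete-dis R []       = Complete-resp (dis-singleton R) (complete R)
    complete-dis R (T ∷ Ts) = Complete-resp (∨-cons R T Ts)
      (Complete-∨ (complete R) (complete-dis T Ts))

    complete-con : ∀ R Rs → Complete (con (R ∷ Rs))
    complete-con R []       = Complete-resp (con-singleton R) (complete R)
    complete-con R (T ∷ Ts) = Complete-resp (∧-cons R T Ts)
      (Complete-∧ (complete R) (complete-con T Ts))

    -- Each case pushes the negation one connective inwards, so the recursion is on the negated
    -- structure; a double negation returns to `complete`.
    complete-neg : ∀ R → Complete (neg R)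
    complete-neg 𝐟              = Complete-resp (≈-sym neg-𝐟) Complete-𝐭
    complete-neg 𝐭              = Complete-resp (≈-sym neg-𝐭) Complete-𝐟
    complete-neg (atom a)       =
      Complete-resp (≈-sym (neg-atom a)) (Complete-atom (dual a))
    complete-neg (dis (R ∷ Rs)) = complete-neg-dis R Rs
    complete-neg (con (R ∷ Rs)) = complete-neg-con R Rs
    complete-neg (neg R)        = Complete-resp (≈-sym (neg-neg R)) (complete R)

    complete-neg-dis : ∀ R Rs → Complete (neg (dis (R ∷ Rs)))
    complete-neg-dis R []       =
      Complete-resp (neg-cong (dis-singleton R)) (complete-neg R)
    complete-neg-dis R (T ∷ Ts) =
      Complete-resp (≈-trans (≈-sym (neg-∨ R _)) (neg-cong (∨-cons R T Ts)))
        (Complete-∧ (complete-neg R) (complete-neg-dis T Ts))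

    complete-neg-con : ∀ R Rs → Complete (neg (con (R ∷ Rs)))
    complete-neg-con R []       =
      Complete-resp (neg-cong (con-singleton R)) (complete-neg R)
    complete-neg-con R (T ∷ Ts) =
      Complete-resp (≈-trans (≈-sym (neg-∧ R _)) (neg-cong (∧-cons R T Ts)))
        (Complete-∨ (complete-neg R) (complete-neg-con T Ts))

  completeness : ∀ R → ⟦ R ⟧ ∋ [] → ⊢ R
  completeness R r =
    -- Truth at `[]` passes to every `Δ`, so any `Δ` implied by `R` is tautological.
    complete R {𝐟} {[]} (λ p f →
      Taut-provable (f ≼-refl (mono ⟦ R ⟧ p r)) ⨾≈ ≈-sym (∨-identityˡ _))
    ⨾≈ ∨-congˡ (∨-identityˡ 𝐟)
    ⨾≈ ∨-identityʳ R

  -- Admissibility from soundness.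

  sound⇒admissible : ∀ {ρ} → Sound ρ → Admissible ρ KSg
  sound⇒admissible {ρ} σ R d = completeness R (derivation-sound rules-sound d tt)
    where
    rules-sound : ∀ {ρ′} → (KSg ∪ ｛ ρ ｝) ρ′ → Sound ρ′
    rules-sound (inj₁ m)    = KSg-sound m
    rules-sound (inj₂ refl) = σ

theorem3p16 : (𝒜 : Atoms) → let open Calculus 𝒜 in
    Admissible i↑ KSg × Admissible w↑ KSg × Admissible c↑ KSg
theorem3p16 𝒜 =
  sound⇒admissible i↑-sound , sound⇒admissible w↑-sound , sound⇒admissible c↑-sound
  where open Admissibility 𝒜
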